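{- Let $n\geq 1$, let $N_1,\ldots,N_n$ be fuzzy negations with $N_1\leq\cdots\leq N_n$ (pointwise), and let $\psi:[0,1]\to[0,1]$ be an automorphism. Then $$\left(\widetilde{N_1\ldots N_n}\right)^{\widetilde{\psi}}=\widetilde{N_1^{\psi}\ldots N_n^{\psi}}.$$
   Context: $L_n([0,1])=\{(x_1,\ldots,x_n)\in[0,1]^n : x_1\leq\cdots\leq x_n\}$, with projections $\pi_i(x_1,\ldots,x_n)=x_i$. A fuzzy negation is a function $N:[0,1]\to[0,1]$ with $N(0)=1$, $N(1)=0$ and $N(x)\geq N(y)$ whenever $x\leq y$. For fuzzy negations $N_1\leq\cdots\leq N_n$, $\widetilde{N_1\ldots N_n}:L_n([0,1])\to L_n([0,1])$ is given by $\widetilde{N_1\ldots N_n}(\mathbf{x})=(N_1(\pi_n(\mathbf{x})),\ldots,N_n(\pi_1(\mathbf{x})))$, i.e. the $i$-th component is $N_i(\pi_{n-i+1}(\mathbf{x}))$. An automorphism of $[0,1]$ is an increasing bijection $\psi:[0,1]\to[0,1]$. The conjugate of $N$ is $N^{\psi}=\psi^{ -1}\circ N\circ\psi$. The map $\widetilde{\psi}:L_n([0,1])\to L_n([0,1])$ is $\widetilde{\psi}(\mathbf{x})=(\psi(\pi_1(\mathbf{x})),\ldots,\psi(\pi_n(\mathbf{x})))$, and for $\mathcal{N}:L_n([0,1])\to L_n([0,1])$, $\mathcal{N}^{\widetilde{\psi}}=\widetilde{\psi}^{ -1}\circ\mathcal{N}\circ\widetilde{\psi}$. -}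

module Defs where

open import Data.Empty using (⊥)
open import Data.Fin.Base as Fin using (Fin; opposite)
open import Data.Fin.Properties using (opposite-prop)
open import Data.Nat.Base as ℕ using (ℕ)
import Data.Nat.Properties as ℕ
open import Data.Product.Base using (∃; _×_; _,_; proj₁; proj₂)
open import Data.Rational.Base as ℚ using (ℚ; 0ℚ; 1ℚ)
import Data.Rational.Properties as ℚ
open import Data.Sum.Base using (_⊎_; inj₁; inj₂)
open import Data.Vec.Functional using (Vector)
import Data.Vec.Functional.Relation.Binary.Pointwise.Properties as Pointwise
open import Function.Bundles using (Bijection; Func; Inverse; Surjection; _⟶ₛ_)
import Function.Construct.Composition as Compose
open import Function.Properties.Bijection using (Bijection⇒Inverse)
open import Level using (Level; 0ℓ) renaming (suc to lsuc)
open import Relation.Binary.Bundles using (Poset; Setoid)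
open import Relation.Binary.Construct.Interior.Symmetric using (_,_)
import Relation.Binary.Construct.Interior.Symmetric as Sym
import Relation.Binary.Construct.On as On
open import Relation.Binary.Definitions using (tri<; tri≈; tri>)
open import Relation.Binary.PropositionalEquality.Core using (refl; sym; subst₂)
import Relation.Binary.Reasoning.Setoid as ≈-Reasoning
open import Relation.Nullary.Negation.Core using (¬_; contradiction)
open import Relation.Unary using (Pred; _⊆_)

private
  variable
    a ℓ : Level
    n : ℕ

-- Two-sided Dedekind cuts.
record ℝ : Set (lsuc 0ℓ) where
  field
    Lower Upper     : Pred ℚ 0ℓ
    lower-inhabited : ∃ Lower
    upper-inhabited : ∃ Upper
    lower-closed    : ∀ {p q} → p ℚ.< q → Lower q → Lower p
    upper-closed    : ∀ {p q} → p ℚ.< q → Upper p → Upper q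
    lower-open      : ∀ {p} → Lower p → ∃ λ q → p ℚ.< q × Lower q
    upper-open      : ∀ {q} → Upper q → ∃ λ p → p ℚ.< q × Upper p
    disjoint        : ∀ {q} → Lower q → Upper q → ⊥
    located         : ∀ {p q} → p ℚ.< q → Lower p ⊎ Upper q

open ℝ

infix 4 _≤ᴿ_ _<ᴿ_

_≤ᴿ_ : ℝ → ℝ → Set
x ≤ᴿ y = Lower x ⊆ Lower y

_<ᴿ_ : ℝ → ℝ → Set
x <ᴿ y = ∃ λ q → Upper x q × Lower y q

<ᴿ⇒≤ᴿ : ∀ x y → x <ᴿ y → x ≤ᴿ y
<ᴿ⇒≤ᴿ x y (q , q∈Ux , q∈Ly) {p} p∈Lx with ℚ.<-cmp p q
... | tri< p<q _ _  = lower-closed y p<q q∈Ly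
... | tri≈ _ refl _ = q∈Ly
... | tri> _ _ q<p  = contradiction q∈Ux (disjoint x (lower-closed x q<p p∈Lx))

<ᴿ⇒≱ᴿ : ∀ x y → x <ᴿ y → ¬ (y ≤ᴿ x)
<ᴿ⇒≱ᴿ x y (q , q∈Ux , q∈Ly) y≤x = disjoint x (y≤x q∈Ly) q∈Ux

≮ᴿ⇒≥ᴿ : ∀ x y → ¬ (x <ᴿ y) → y ≤ᴿ x
≮ᴿ⇒≥ᴿ x y x≮y p∈Ly with lower-open y p∈Ly
... | q , p<q , q∈Ly with located x p<q
...   | inj₁ p∈Lx = p∈Lx
...   | inj₂ q∈Ux = contradiction (q , q∈Ux , q∈Ly) x≮y

fromℚ : ℚ → ℝ
fromℚ r = record
  { Lower           = ℚ._< r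
  ; Upper           = r ℚ.<_
  ; lower-inhabited = r ℚ.- 1ℚ , subst₂ ℚ._<_ refl (ℚ.+-identityʳ r)
                        (ℚ.+-monoʳ-< r (ℚ.negative⁻¹ (ℚ.- 1ℚ)))
  ; upper-inhabited = r ℚ.+ 1ℚ , subst₂ ℚ._<_ (ℚ.+-identityʳ r) refl
                        (ℚ.+-monoʳ-< r (ℚ.positive⁻¹ 1ℚ))
  ; lower-closed    = ℚ.<-trans
  ; upper-closed    = λ p<q r<p → ℚ.<-trans r<p p<q
  ; lower-open      = ℚ.<-dense
  ; upper-open      = λ r<q → let m , r<m , m<q = ℚ.<-dense r<q in m , m<q , r<m
  ; disjoint        = ℚ.<-asym
  ; located         = locate
  }
  where
  locate : ∀ {p q} → p ℚ.< q → p ℚ.< r ⊎ r ℚ.< q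
  locate {p} p<q with ℚ.<-cmp p r
  ... | tri< p<r _ _  = inj₁ p<r
  ... | tri≈ _ refl _ = inj₂ p<q
  ... | tri> _ _ r<p  = inj₂ (ℚ.<-trans r<p p<q)

record 𝕀 : Set (lsuc 0ℓ) where
  constructor mk𝕀
  field
    value   : ℝ
    0≤value : fromℚ 0ℚ ≤ᴿ value
    value≤1 : value ≤ᴿ fromℚ 1ℚ

open 𝕀

infix 4 _≤_

-- A record rather than a synonym, so that x and y can be inferred.
record _≤_ (x y : 𝕀) : Set where
  constructor *≤*
  field
    value-≤ : value x ≤ᴿ value y

open _≤_

-- The equality x ≈ y of this poset is x ≤ y together with y ≤ x.
𝕀-poset : Poset (lsuc 0ℓ) 0ℓ 0ℓ
𝕀-poset = Sym.poset {R = _≤_}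
  (*≤* λ p → p)
  (λ x≤y y≤z → *≤* λ p → value-≤ y≤z (value-≤ x≤y p))

module 𝕀ₚ = Poset 𝕀-poset
open 𝕀ₚ public using (_≈_)

𝕀-setoid : Setoid (lsuc 0ℓ) 0ℓ
𝕀-setoid = 𝕀ₚ.Eq.setoid

private
  0≤1 : fromℚ 0ℚ ≤ᴿ fromℚ 1ℚ
  0≤1 p<0 = ℚ.<-trans p<0 (ℚ.positive⁻¹ 1ℚ)

0𝕀 1𝕀 : 𝕀
0𝕀 = mk𝕀 (fromℚ 0ℚ) (λ p → p) 0≤1
1𝕀 = mk𝕀 (fromℚ 1ℚ) 0≤1 (λ p → p)

inverse : {S : Setoid a ℓ} → Bijection S S → S ⟶ₛ S
inverse ψ = record { to = from ; cong = from-cong }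
  where open Inverse (Bijection⇒Inverse ψ)

infixl 8 _^_

-- f ^ ψ = ψ⁻¹ ∘ f ∘ ψ: Compose.function takes the map applied first as its
-- first argument.
_^_ : {S : Setoid a ℓ} → S ⟶ₛ S → Bijection S S → S ⟶ₛ S
f ^ ψ = Compose.function (Compose.function (Surjection.function (Bijection.surjection ψ)) f) (inverse ψ)

infix 4 _≗_

_≗_ : {S : Setoid a ℓ} → S ⟶ₛ S → S ⟶ₛ S → Set _
_≗_ {S = S} f g = ∀ x → Setoid._≈_ S (Func.to f x) (Func.to g x)

-- For a bijection, the non-strict monotonicity required here is implied by
-- (and classically equivalent to) the strict one.
record Automorphism : Set (lsuc 0ℓ) where
  field
    bijection  : Bijection 𝕀-setoid 𝕀-setoid
    increasing : ∀ {x y} → x ≤ y → Bijection.to bijection x ≤ Bijection.to bijection y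

  open Bijection bijection public using (to; cong; injective; to⁻; strictlySurjective)

  to∘to⁻ : ∀ x → to (to⁻ x) ≈ x
  to∘to⁻ x = proj₂ (strictlySurjective x)

  to⁻-increasing : ∀ {x y} → x ≤ y → to⁻ x ≤ to⁻ y
  to⁻-increasing {x} {y} x≤y = *≤* (≮ᴿ⇒≥ᴿ (value (to⁻ y)) (value (to⁻ x)) λ y⁻<x⁻ →
    let
      y⁻≤x⁻ : to⁻ y ≤ to⁻ x
      y⁻≤x⁻ = *≤* (<ᴿ⇒≤ᴿ (value (to⁻ y)) (value (to⁻ x)) y⁻<x⁻)
      y≤x : y ≤ x
      y≤x = 𝕀ₚ.≤-respʳ-≈ (to∘to⁻ x) (𝕀ₚ.≤-respˡ-≈ (to∘to⁻ y) (increasing y⁻≤x⁻))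
      x⁻≈y⁻ : to⁻ x ≈ to⁻ y
      x⁻≈y⁻ = Func.cong (inverse bijection) (x≤y , y≤x)
    in <ᴿ⇒≱ᴿ (value (to⁻ y)) (value (to⁻ x)) y⁻<x⁻ (value-≤ (𝕀ₚ.reflexive x⁻≈y⁻)))

-- A function on [0,1] is a map of setoids, since reals have many representing
-- cuts.
record FuzzyNegation : Set (lsuc 0ℓ) where
  field
    function : 𝕀-setoid ⟶ₛ 𝕀-setoid

  open Func function public using (to; cong)

  field
    to-0       : to 0𝕀 ≈ 1𝕀
    to-1       : to 1𝕀 ≈ 0𝕀
    decreasing : ∀ {x y} → x ≤ y → to y ≤ to x

Ascending : (Fin n → FuzzyNegation) → Set _
Ascending N = ∀ {i j} → i Fin.≤ j → ∀ x → FuzzyNegation.to (N i) x ≤ FuzzyNegation.to (N j) x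

module _ (N : FuzzyNegation) (ψ : Automorphism) where

  private
    module N = FuzzyNegation N
    module ψ = Automorphism ψ

    0-min : ∀ x → 0𝕀 ≤ x
    0-min x = *≤* (0≤value x)

    1-max : ∀ x → x ≤ 1𝕀
    1-max x = *≤* (value≤1 x)

    ψ0≈0 : ψ.to 0𝕀 ≈ 0𝕀
    ψ0≈0 = 𝕀ₚ.antisym
      (𝕀ₚ.≤-respʳ-≈ (ψ.to∘to⁻ 0𝕀) (ψ.increasing (0-min (ψ.to⁻ 0𝕀))))
      (0-min (ψ.to 0𝕀))

    ψ1≈1 : ψ.to 1𝕀 ≈ 1𝕀
    ψ1≈1 = 𝕀ₚ.antisym
      (1-max (ψ.to 1𝕀))
      (𝕀ₚ.≤-respˡ-≈ (ψ.to∘to⁻ 1𝕀) (ψ.increasing (1-max (ψ.to⁻ 1𝕀))))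

    conjugate-value : ∀ {x y} → N.to x ≈ y → ψ.to x ≈ x → ψ.to y ≈ y →
                      ψ.to⁻ (N.to (ψ.to x)) ≈ y
    conjugate-value {x} {y} Nx≈y ψx≈x ψy≈y = ψ.injective (begin
      ψ.to (ψ.to⁻ (N.to (ψ.to x))) ≈⟨ ψ.to∘to⁻ (N.to (ψ.to x)) ⟩
      N.to (ψ.to x)                ≈⟨ N.cong ψx≈x ⟩
      N.to x                       ≈⟨ Nx≈y ⟩
      y                            ≈⟨ ψy≈y ⟨
      ψ.to y                       ∎)
      where open ≈-Reasoning 𝕀-setoid

  conjugate : FuzzyNegation
  conjugate = record
    { function   = N.function ^ ψ.bijection
    ; to-0       = conjugate-value N.to-0 ψ0≈0 ψ1≈1
    ; to-1       = conjugate-value N.to-1 ψ1≈1 ψ0≈0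
    ; decreasing = λ x≤y → ψ.to⁻-increasing (N.decreasing (ψ.increasing x≤y))
    }

conjugate-ascending : (N : Fin n → FuzzyNegation) (ψ : Automorphism) →
                      Ascending N → Ascending (λ i → conjugate (N i) ψ)
conjugate-ascending N ψ N↗ i≤j x = ψ.to⁻-increasing (N↗ i≤j (ψ.to x))
  where module ψ = Automorphism ψ

record L (n : ℕ) : Set (lsuc 0ℓ) where
  constructor mkL
  field
    coords    : Vector 𝕀 n
    ascending : ∀ {i j} → i Fin.≤ j → coords i ≤ coords j

open L

π : Fin n → L n → 𝕀
π i x = coords x i

L-setoid : ℕ → Setoid (lsuc 0ℓ) 0ℓ
L-setoid n = On.setoid (Pointwise.setoid 𝕀-setoid n) (coords {n})

opposite-antitone : {i j : Fin n} → i Fin.≤ j → opposite j Fin.≤ opposite i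
opposite-antitone {n} {i} {j} i≤j =
  subst₂ ℕ._≤_ (sym (opposite-prop j)) (sym (opposite-prop i))
    (ℕ.∸-monoʳ-≤ n (ℕ.s≤s i≤j))

-- With indices counted from 0, opposite sends i to n - 1 - i.
negation~ : (N : Fin n → FuzzyNegation) → Ascending N → L-setoid n ⟶ₛ L-setoid n
negation~ {n} N N↗ = record
  { to   = λ x → mkL (λ i → N.to i (π (opposite i) x)) λ {i} {j} i≤j →
      𝕀ₚ.trans (N↗ i≤j (π (opposite i) x))
               (N.decreasing j (ascending x (opposite-antitone i≤j)))
  ; cong = λ x≈y i → N.cong i (x≈y (opposite i))
  }
  where module N (i : Fin n) = FuzzyNegation (N i)

automorphism~ : Automorphism → Bijection (L-setoid n) (L-setoid n)
automorphism~ {n} ψ = record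
  { to        = ψ̃
  ; cong      = λ x≈y i → ψ.cong (x≈y i)
  ; bijective = (λ ψx≈ψy i → ψ.injective (ψx≈ψy i))
              , λ y → preimage y , λ z≈ i →
                  proj₂ (Bijection.surjective ψ.bijection (π i y)) (z≈ i)
  }
  where
  module ψ = Automorphism ψ

  ψ̃ preimage : L n → L n
  ψ̃ x        = mkL (λ i → ψ.to (π i x)) λ i≤j → ψ.increasing (ascending x i≤j)
  preimage y = mkL (λ i → ψ.to⁻ (π i y)) λ i≤j → ψ.to⁻-increasing (ascending y i≤j)

{-# OPTIONS --safe #-}
module Submission where

open import Defs
open import Data.Fin.Base using (Fin)
open import Data.Nat.Base using (ℕ; _≥_)

-- The inverse of automorphism~ ψ is ψ⁻¹ in each coordinate by construction, so
-- both sides have ψ⁻¹ (N i (ψ (π (opposite i) x))) as their i-th coordinate.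
proposition34 : (n : ℕ) → n ≥ 1 →
    (N : Fin n → FuzzyNegation) (N↗ : Ascending N) (ψ : Automorphism) →
    negation~ N N↗ ^ automorphism~ ψ
    ≗ negation~ (λ i → conjugate (N i) ψ) (conjugate-ascending N ψ N↗)
-- `L-setoid` compares coordinates only, so the two proofs of ascent need not match. Applying one
-- map in every coordinate commutes with the reversal `opposite`, and the inverse in `_^_` unfolds
-- to the surjectivity witness `preimage`, built from the same `ψ.to⁻` as in `conjugate`; hence
-- reflexivity suffices.
proposition34 n n≥1 N N↗ ψ x i = 𝕀ₚ.Eq.refl
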